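{- Let $p$ be an odd prime, let $\alpha,\beta$ be positive integers, and let $G = \mathbb{Z}_{p^{\alpha}}\oplus\mathbb{Z}_{p^\beta}$. Let $A=\{a\in\mathbb{N} : 1\le a\le p^{\max(\alpha,\beta)},\ \gcd(a,p)=1\}$. Then $\eta_A(G) = \alpha + \beta + 1$.
   Context: $\mathbb{Z}_n$ denotes the cyclic group $\mathbb{Z}/n\mathbb{Z}$. A sequence over a finite abelian group $G$ (written additively) is a finite list of elements of $G$, repetitions allowed, order irrelevant; its length is its number of terms, and a subsequence is obtained by choosing a subset of the indices. For a set of integers $A$, a sequence $x_1\cdots x_k$ over $G$ ($k\ge 1$) is an $A$-weighted zero-sum sequence of length $k$ if there exist $u_1,\dots,u_k\in A$ (not necessarily distinct) with $u_1x_1+\cdots+u_kx_k=0$ in $G$. If $G$ has exponent $n$, $\eta_A(G)$ is the smallest integer $\ell$ such that every sequence over $G$ of length at least $\ell$ has a nonempty $A$-weighted zero-sum subsequence of length at most $n$. The exponent of $\mathbb{Z}_{p^\alpha}\oplus\mathbb{Z}_{p^\beta}$ is $p^{\max(\alpha,\beta)}$. -}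

module Defs where

open import Algebra.Bundles using (AbelianGroup)
import Algebra.Construct.DirectProduct as DirectProduct
import Algebra.Definitions.RawMonoid as RawMonoidDefs
open import Data.Integer.Base as ℤ using (ℤ; +_; -[1+_])
open import Data.Integer.Divisibility.Signed using (_∣_; divides; ∣m∣n⇒∣m+n; ∣m⇒∣-m)
import Data.Integer.Properties as ℤ
open import Data.Integer.Tactic.RingSolver using (solve-∀)
open import Data.List.Base using (List; length; lookup)
open import Data.List.Relation.Binary.Sublist.Propositional using (_⊆_)
open import Data.Nat.Base as ℕ using (ℕ; suc; _≤_; _^_; _⊔_)
open import Data.Nat.GCD using (gcd)
open import Data.Product.Base using (Σ-syntax; ∃-syntax; _×_; _,_)
open import Data.Vec.Functional using (Vector)
open import Level using (0ℓ) renaming (_⊔_ to _⊔ˡ_)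
open import Relation.Binary.PropositionalEquality.Core using (_≡_; refl; subst)
open import Relation.Unary using (Pred; _∈_)

IsLeast : ∀ {a} → Pred ℕ a → Pred ℕ a
IsLeast P n = n ∈ P × (∀ m → m ∈ P → n ≤ m)

-- The cyclic group ℤ/nℤ, as the integers with congruence modulo n for equality.

infix 4 _≡_[mod_]

_≡_[mod_] : ℤ → ℤ → ℕ → Set
x ≡ y [mod n ] = + n ∣ x ℤ.- y

private
  ≡⇒≡mod : ∀ n {x y} → x ≡ y → x ≡ y [mod n ]
  ≡⇒≡mod n {x} refl = divides (+ 0) (ℤ.+-inverseʳ x)

  sym-eq : ∀ x y → ℤ.- (x ℤ.- y) ≡ y ℤ.- x
  sym-eq = solve-∀

  trans-eq : ∀ x y z → (x ℤ.- y) ℤ.+ (y ℤ.- z) ≡ x ℤ.- z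
  trans-eq = solve-∀

  +-eq : ∀ x y u v → (x ℤ.- y) ℤ.+ (u ℤ.- v) ≡ (x ℤ.+ u) ℤ.- (y ℤ.+ v)
  +-eq = solve-∀

  neg-eq : ∀ x y → ℤ.- (x ℤ.- y) ≡ (ℤ.- x) ℤ.- (ℤ.- y)
  neg-eq = solve-∀

ℤ-mod : ℕ → AbelianGroup 0ℓ 0ℓ
ℤ-mod n = record
  { Carrier = ℤ
  ; _≈_     = _≡_[mod n ]
  ; _∙_     = ℤ._+_
  ; ε       = + 0
  ; _⁻¹     = ℤ.-_
  ; isAbelianGroup = record
    { isGroup = record
      { isMonoid = record
        { isSemigroup = record
          { isMagma = record
            { isEquivalence = record
              { refl  = λ {x} → ≡⇒≡mod n {x} refl
              ; sym   = λ {x} {y} p → subst (+ n ∣_) (sym-eq x y) (∣m⇒∣-m p)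
              ; trans = λ {x} {y} {z} p q →
                  subst (+ n ∣_) (trans-eq x y z) (∣m∣n⇒∣m+n p q)
              }
            ; ∙-cong = λ {x} {y} {u} {v} p q →
                subst (+ n ∣_) (+-eq x y u v) (∣m∣n⇒∣m+n p q)
            }
          ; assoc = λ x y z → ≡⇒≡mod n (ℤ.+-assoc x y z)
          }
        ; identity = (λ x → ≡⇒≡mod n (ℤ.+-identityˡ x))
                   , (λ x → ≡⇒≡mod n (ℤ.+-identityʳ x))
        }
      ; inverse = (λ x → ≡⇒≡mod n (ℤ.+-inverseˡ x))
                , (λ x → ≡⇒≡mod n (ℤ.+-inverseʳ x))
      ; ⁻¹-cong = λ {x} {y} p → subst (+ n ∣_) (neg-eq x y) (∣m⇒∣-m p)
      }
    ; comm = λ x y → ≡⇒≡mod n (ℤ.+-comm x y)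
    }
  }

infixr 6 _⊕_

_⊕_ : ∀ {a b ℓ₁ ℓ₂} → AbelianGroup a ℓ₁ → AbelianGroup b ℓ₂ →
      AbelianGroup (a ⊔ˡ b) (ℓ₁ ⊔ˡ ℓ₂)
_⊕_ = DirectProduct.abelianGroup

module _ {g ℓ} (G : AbelianGroup g ℓ) where

  open AbelianGroup G
  open RawMonoidDefs rawMonoid using (sum) renaming (_×_ to _ℕ·_)

  infixr 8 _ℤ·_

  _ℤ·_ : ℤ → Carrier → Carrier
  (+ n)    ℤ· x = n ℕ· x
  -[1+ n ] ℤ· x = (suc n ℕ· x) ⁻¹

  IsExponent : Pred ℕ _
  IsExponent = IsLeast λ n → 1 ≤ n × (∀ x → n ℕ· x ≈ ε)

  module _ {a} (A : Pred ℤ a) where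

    WeightedZeroSum : Pred (List Carrier) _
    WeightedZeroSum xs = 1 ≤ length xs ×
      Σ[ u ∈ Vector ℤ (length xs) ]
        ((∀ i → u i ∈ A) × sum (λ i → u i ℤ· lookup xs i) ≈ ε)

    HasShortZeroSum : ℕ → Pred (List Carrier) _
    HasShortZeroSum n xs = ∃[ ys ] (ys ⊆ xs × length ys ≤ n × WeightedZeroSum ys)

    -- "η_A(G) = l".  Taking l ∈ ℕ loses nothing against "smallest integer":
    -- for l ≤ 0 the defining property fails on the empty sequence.
    IsEta : Pred ℕ _
    IsEta l = ∃[ n ] (IsExponent n ×
      IsLeast (λ k → ∀ xs → k ≤ length xs → HasShortZeroSum n xs) l)

UnitWeights : ℕ → ℕ → ℕ → Pred ℤ 0ℓ
UnitWeights p α β z =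
  ∃[ a ] (z ≡ + a × 1 ≤ a × a ≤ p ^ (α ⊔ β) × gcd a p ≡ 1)

{-# OPTIONS --safe #-}

-- For the upper bound, pigeonhole the p ^ (α + β + 1) sums with coefficients in
-- {0, …, p − 1}: two of them agree, and in their difference every coefficient
-- is either zero or prime to p.  Deleting the terms with zero coefficient leaves
-- a weighted zero-sum subsequence, and α + β + 1 ≤ p ^ max(α, β) as p ≥ 3.
-- For the lower bound, take (p ^ i, 0) for i < α and (0, p ^ j) for j < β: in a
-- combination with unit weights the smallest power in a coordinate survives.

module Submission where

open import Defs
open import Algebra.Bundles using (AbelianGroup)
import Algebra.Definitions.RawMonoid as RawMonoidDefs
open import Data.Fin.Base using (Fin; zero; suc; toℕ; fromℕ<; combine; finToFun; funToFin)
open import Data.Fin.Properties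
  using (toℕ<n; toℕ-injective; fromℕ<-injective; combine-injective;
         funToFin-finToFin; pigeonhole; ¬∀⟶∃¬; <⇒≢)
open import Data.Integer.Base as ℤ using (ℤ; +_; -[1+_]; ∣_∣)
open import Data.Integer.DivMod using (_%ℕ_; _/ℕ_; n%ℕd<d; a≡a%ℕn+[a/ℕn]*n)
open import Data.Integer.Divisibility.Signed
  using (_∣_; divides; ∣-trans; ∣⇒∣ᵤ; ∣ᵤ⇒∣; ∣m∣n⇒∣m+n; ∣m∣n⇒∣m-n;
         ∣m+n∣n⇒∣m; ∣n⇒∣m*n; ∣m⇒∣m*n; *-cancelʳ-∣)
import Data.Integer.Properties as ℤ
open import Data.Integer.Tactic.RingSolver using (solve-∀)
open import Data.List.Base using (List; []; _∷_; length; lookup; take)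
open import Data.List.Membership.Propositional.Properties using (∈-lookup)
open import Data.List.Properties using (length-take)
open import Data.List.Relation.Binary.Sublist.Propositional
  using (_⊆_; []; _∷_; _∷ʳ_; ⊆-trans)
open import Data.List.Relation.Binary.Sublist.Propositional.Properties
  using (take-⊆; length-mono-≤; All-resp-⊆)
open import Data.List.Relation.Unary.All as All using (All; []; _∷_)
open import Data.Nat.Base as ℕ
  using (ℕ; zero; suc; _+_; _*_; _^_; _≤_; _<_; _⊔_; z≤n; s≤s; NonZero)
open import Data.Nat.Coprimality using (coprime⇒gcd≡1; gcd≡1⇒coprime)
open import Data.Nat.Divisibility as ℕ∣ using (_∤_)
open import Data.Nat.GCD using (gcd)
open import Data.Nat.Primality
  using (Prime; prime⇒nonZero; prime⇒nonTrivial; prime⇒irreducible)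
import Data.Nat.Properties as ℕ
open import Data.Product.Base using (∃-syntax; _×_; _,_; proj₁; proj₂)
open import Data.Sum.Base using (_⊎_; inj₁; inj₂)
open import Data.Vec.Functional using (Vector)
open import Function.Base using (_∘_)
open import Relation.Binary.PropositionalEquality
open import Relation.Nullary using (¬_; yes; no; contradiction)
open import Relation.Unary using (_∈_)

-- Integer dot products and residues.

dot : ∀ {n} → Vector ℤ n → Vector ℤ n → ℤ
dot {zero}  c x = + 0
dot {suc n} c x = c zero ℤ.* x zero ℤ.+ dot (c ∘ suc) (x ∘ suc)

dot-distribʳ-- : ∀ {n} (c d x : Vector ℤ n) →
                 dot (λ i → c i ℤ.- d i) x ≡ dot c x ℤ.- dot d x
dot-distribʳ-- {zero}  c d x = refl
dot-distribʳ-- {suc n} c d x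
  rewrite dot-distribʳ-- (c ∘ suc) (d ∘ suc) (x ∘ suc) =
  eq (c zero) (d zero) (x zero) _ _
  where
  eq : ∀ c d x s t → (c ℤ.- d) ℤ.* x ℤ.+ (s ℤ.- t) ≡ (c ℤ.* x ℤ.+ s) ℤ.- (d ℤ.* x ℤ.+ t)
  eq = solve-∀

∣-dot : ∀ {k n} (c x : Vector ℤ n) → (∀ i → k ∣ x i) → k ∣ dot c x
∣-dot {n = zero}  c x k∣x = divides (+ 0) refl
∣-dot {n = suc n} c x k∣x =
  ∣m∣n⇒∣m+n (∣n⇒∣m*n (c zero) (k∣x zero)) (∣-dot (c ∘ suc) (x ∘ suc) (k∣x ∘ suc))

%ℕ-≡mod : ∀ z d .{{_ : NonZero d}} → (+ (z %ℕ d)) ≡ z [mod d ]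
%ℕ-≡mod z d = divides (ℤ.- (z /ℕ d)) (begin
  + (z %ℕ d) ℤ.- z                                       ≡⟨ cong (λ w → + (z %ℕ d) ℤ.- w) (a≡a%ℕn+[a/ℕn]*n z d) ⟩
  + (z %ℕ d) ℤ.- (+ (z %ℕ d) ℤ.+ (z /ℕ d) ℤ.* + d)       ≡⟨ eq (+ (z %ℕ d)) (z /ℕ d) (+ d) ⟩
  ℤ.- (z /ℕ d) ℤ.* + d                                   ∎)
  where
  open ≡-Reasoning
  eq : ∀ r q d → r ℤ.- (r ℤ.+ q ℤ.* d) ≡ ℤ.- q ℤ.* d
  eq = solve-∀

%ℕ-injective-mod : ∀ z w d .{{_ : NonZero d}} → z %ℕ d ≡ w %ℕ d → z ≡ w [mod d ]
%ℕ-injective-mod z w d eq = subst (+ d ∣_) (ring (+ (w %ℕ d)) z w)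
  (∣m∣n⇒∣m-n (%ℕ-≡mod w d) (subst (λ r → + r ≡ z [mod d ]) eq (%ℕ-≡mod z d)))
  where
  ring : ∀ r z w → (r ℤ.- w) ℤ.- (r ℤ.- z) ≡ z ℤ.- w
  ring = solve-∀

-- Siegel's lemma modulo a and b, by the pigeonhole principle.
small-solution : ∀ {n} p a b .{{_ : NonZero a}} .{{_ : NonZero b}} → a * b < p ^ n →
  (x y : Vector ℤ n) →
  ∃[ c ] ((∀ i → ∣ c i ∣ < p) × (∃[ i ] c i ≢ + 0) × (+ a ∣ dot c x) × (+ b ∣ dot c y))
small-solution {n} p a b ab<pⁿ x y =
  c , small , nonzero , agree a x (proj₁ same-residues) , agree b y (proj₂ same-residues)
  where
  -- An index below `p ^ n` is read as its `n` digits in base `p`.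
  coeff : Fin (p ^ n) → Vector ℤ n
  coeff k l = + toℕ (finToFun k l)

  residue : ∀ d .{{_ : NonZero d}} → ℤ → Fin d
  residue d z = fromℕ< (n%ℕd<d z d)

  residues : Fin (p ^ n) → Fin (a * b)
  residues k = combine (residue a (dot (coeff k) x)) (residue b (dot (coeff k) y))

  collision = pigeonhole ab<pⁿ residues
  i = proj₁ collision
  j = proj₁ (proj₂ collision)
  i<j = proj₁ (proj₂ (proj₂ collision))
  same-residues = combine-injective _ _ _ _ (proj₂ (proj₂ (proj₂ collision)))

  c : Vector ℤ n
  c l = coeff i l ℤ.- coeff j l

  small : ∀ l → ∣ c l ∣ < p
  small l = subst (λ z → ∣ z ∣ < p) (sym (ℤ.m-n≡m⊖n iₗ jₗ))
    (ℕ.≤-<-trans (ℤ.∣m⊝n∣≤m⊔n iₗ jₗ)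
                 (ℕ.⊔-pres-<m (toℕ<n (finToFun i l)) (toℕ<n (finToFun j l))))
    where
    iₗ = toℕ (finToFun i l)
    jₗ = toℕ (finToFun j l)

  -- Two digit functions are only known to agree pointwise, so `funToFin` has to be shown to respect
  -- `≗`.
  funToFin-cong : ∀ {m n} {f g : Fin m → Fin n} → f ≗ g → funToFin f ≡ funToFin g
  funToFin-cong {zero}  f≗g = refl
  funToFin-cong {suc m} f≗g = cong₂ combine (f≗g zero) (funToFin-cong (f≗g ∘ suc))

  nonzero : ∃[ l ] c l ≢ + 0
  nonzero = ¬∀⟶∃¬ n _ (λ l → c l ℤ.≟ + 0) λ c≡0 → <⇒≢ i<j (begin
    i                             ≡⟨ funToFin-finToFin {n} i ⟨
    funToFin (finToFun {p} {n} i) ≡⟨ funToFin-cong (λ l → toℕ-injective (ℤ.+-injective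
                                     (ℤ.i-j≡0⇒i≡j _ _ (c≡0 l)))) ⟩
    funToFin (finToFun {p} {n} j) ≡⟨ funToFin-finToFin {n} j ⟩
    j                             ∎)
    where open ≡-Reasoning

  agree : ∀ d .{{_ : NonZero d}} (z : Vector ℤ n) →
          residue d (dot (coeff i) z) ≡ residue d (dot (coeff j) z) → + d ∣ dot c z
  agree d z eq = subst (+ d ∣_) (sym (dot-distribʳ-- (coeff i) (coeff j) z))
    (%ℕ-injective-mod (dot (coeff i) z) (dot (coeff j) z) d (fromℕ<-injective _ _ _ _ eq))

-- Divisibility and growth of powers.

^-monoʳ-∣ : ∀ p {m n} → m ≤ n → + (p ^ m) ∣ + (p ^ n)
^-monoʳ-∣ p {m} {n} m≤n = ∣ᵤ⇒∣ {+ (p ^ m)} {+ (p ^ n)} (subst (p ^ m ℕ∣.∣_)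
  (trans (sym (ℕ.^-distribˡ-+-* p m (n ℕ.∸ m))) (cong (p ^_) (ℕ.m+[n∸m]≡n m≤n)))
  (ℕ∣.m∣m*n (p ^ (n ℕ.∸ m))))

-- Of three copies of `p ^ n`, one absorbs the induction hypothesis and the other two supply the
-- extra 2. This is where an odd prime matters: for base 2 the bound fails at `n = 1`.
1+n+n≤p^n : ∀ {p} → 3 ≤ p → ∀ n → suc (n + n) ≤ p ^ n
1+n+n≤p^n 3≤p zero    = ℕ.≤-refl
1+n+n≤p^n {p} 3≤p (suc n) = begin
  suc (suc n + suc n)          ≡⟨ cong (_+_ 2) (ℕ.+-suc n n) ⟩
  1 + (1 + suc (n + n))        ≤⟨ ℕ.+-mono-≤ 1≤p^n (ℕ.+-mono-≤ 1≤p^n ih) ⟩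
  p ^ n + (p ^ n + p ^ n)      ≡⟨ cong (λ k → p ^ n + (p ^ n + k)) (ℕ.+-identityʳ (p ^ n)) ⟨
  3 * p ^ n                    ≤⟨ ℕ.*-monoˡ-≤ (p ^ n) 3≤p ⟩
  p * p ^ n                    ∎
  where
  open ℕ.≤-Reasoning
  ih = 1+n+n≤p^n 3≤p n
  1≤p^n : 1 ≤ p ^ n
  1≤p^n = ℕ.≤-trans (s≤s z≤n) ih

-- Coordinates and exponent of the group.

module _ (p α β : ℕ) where

  private
    G = ℤ-mod (p ^ α) ⊕ ℤ-mod (p ^ β)
    module G = AbelianGroup G
    open RawMonoidDefs G.rawMonoid using (sum) renaming (_×_ to _ℕ·_)

    infixr 8 _·_
    _·_ : ℤ → ℤ × ℤ → ℤ × ℤ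
    _·_ = _ℤ·_ G

    A = UnitWeights p α β

  ℕ·-componentwise : ∀ n a b → n ℕ· (a , b) ≡ (+ n ℤ.* a , + n ℤ.* b)
  ℕ·-componentwise zero    a b = refl
  ℕ·-componentwise (suc n) a b rewrite ℕ·-componentwise n a b =
    cong₂ _,_ (sym (ℤ.suc-* (+ n) a)) (sym (ℤ.suc-* (+ n) b))

  ·-componentwise : ∀ z a b → z · (a , b) ≡ (z ℤ.* a , z ℤ.* b)
  ·-componentwise (+ n)    a b = ℕ·-componentwise n a b
  ·-componentwise -[1+ n ] a b = trans (cong G._⁻¹ (ℕ·-componentwise (suc n) a b))
    (cong₂ _,_ (ℤ.neg-distribˡ-* (+ suc n) a) (ℤ.neg-distribˡ-* (+ suc n) b))

  -- Translates weighted sums in the group into pairs of integer dot products, on which the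
  -- pigeonhole and divisibility arguments operate.
  sum-componentwise : ∀ {n} (c : Vector ℤ n) (x : Vector (ℤ × ℤ) n) →
    sum (λ i → c i · x i) ≡ (dot c (proj₁ ∘ x) , dot c (proj₂ ∘ x))
  sum-componentwise {zero}  c x = refl
  sum-componentwise {suc n} c x
    rewrite ·-componentwise (c zero) (proj₁ (x zero)) (proj₂ (x zero))
          | sum-componentwise (c ∘ suc) (x ∘ suc) = refl

  ∣⇒≈ε : ∀ {a b} → + (p ^ α) ∣ a → + (p ^ β) ∣ b → (a , b) G.≈ G.ε
  ∣⇒≈ε {a} {b} p∣a p∣b = subst (+ (p ^ α) ∣_) (sym (ℤ.+-identityʳ a)) p∣a
                       , subst (+ (p ^ β) ∣_) (sym (ℤ.+-identityʳ b)) p∣b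

  ≈ε⇒∣ : ∀ a b → (a , b) G.≈ G.ε → (+ (p ^ α) ∣ a) × (+ (p ^ β) ∣ b)
  ≈ε⇒∣ a b (p∣a , p∣b) = subst (+ (p ^ α) ∣_) (ℤ.+-identityʳ a) p∣a
                           , subst (+ (p ^ β) ∣_) (ℤ.+-identityʳ b) p∣b

  sum≈ε⇒∣ : ∀ {n} (u : Vector ℤ n) (x : Vector (ℤ × ℤ) n) → sum (λ i → u i · x i) G.≈ G.ε →
            (+ (p ^ α) ∣ dot u (proj₁ ∘ x)) × (+ (p ^ β) ∣ dot u (proj₂ ∘ x))
  sum≈ε⇒∣ u x = ≈ε⇒∣ (dot u (proj₁ ∘ x)) (dot u (proj₂ ∘ x))
              ∘ subst (G._≈ G.ε) (sum-componentwise u x)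

  -- Both moduli divide `p ^ (α ⊔ β)`, so a coefficient may be replaced by its residue in the range
  -- of admissible weights.
  ·-congʳ-mod : ∀ {u z} x → u ≡ z [mod p ^ (α ⊔ β) ] → u · x G.≈ z · x
  ·-congʳ-mod {u} {z} (a , b) u≡z
    rewrite ·-componentwise u a b | ·-componentwise z a b =
      subst (_ ∣_) (eq u z a) (∣m⇒∣m*n a (∣-trans (^-monoʳ-∣ p (ℕ.m≤m⊔n α β)) u≡z))
    , subst (_ ∣_) (eq u z b) (∣m⇒∣m*n b (∣-trans (^-monoʳ-∣ p (ℕ.m≤n⊔m α β)) u≡z))
    where
    eq : ∀ u z a → (u ℤ.- z) ℤ.* a ≡ u ℤ.* a ℤ.- z ℤ.* a
    eq = solve-∀

  exponent : .{{_ : NonZero p}} → IsExponent G (p ^ (α ⊔ β))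
  exponent = (ℕ.m^n>0 p (α ⊔ β) , annihilates) , least
    where
    annihilates : ∀ x → (p ^ (α ⊔ β)) ℕ· x G.≈ G.ε
    annihilates (a , b) = subst (G._≈ G.ε) (sym (ℕ·-componentwise (p ^ (α ⊔ β)) a b))
      (∣⇒≈ε (∣m⇒∣m*n a (^-monoʳ-∣ p (ℕ.m≤m⊔n α β))) (∣m⇒∣m*n b (^-monoʳ-∣ p (ℕ.m≤n⊔m α β))))

    least : ∀ m → 1 ≤ m × (∀ x → m ℕ· x G.≈ G.ε) → p ^ (α ⊔ β) ≤ m
    least m@(suc _) (_ , m·x≈ε) = below (ℕ.⊔-sel α β)
      where
      -- The element `(1 , 1)` has maximal order: if `m` kills it, both `p ^ α` and `p ^ β` divide
      -- `m`.
      p∣m = ≈ε⇒∣ (+ m ℤ.* + 1) (+ m ℤ.* + 1)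
              (subst (G._≈ G.ε) (ℕ·-componentwise m (+ 1) (+ 1)) (m·x≈ε (+ 1 , + 1)))

      divisor≤m : ∀ e → + (p ^ e) ∣ + m ℤ.* + 1 → p ^ e ≤ m
      divisor≤m e pᵉ∣m = ℕ∣.∣⇒≤ (∣⇒∣ᵤ {+ (p ^ e)} {+ m}
        (subst (+ (p ^ e) ∣_) (ℤ.*-identityʳ (+ m)) pᵉ∣m))

      below : α ⊔ β ≡ α ⊎ α ⊔ β ≡ β → p ^ (α ⊔ β) ≤ m
      below (inj₁ eq) = subst (λ e → p ^ e ≤ m) (sym eq) (divisor≤m α (proj₁ p∣m))
      below (inj₂ eq) = subst (λ e → p ^ e ≤ m) (sym eq) (divisor≤m β (proj₂ p∣m))

  -- Unit weights and the upper bound.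

  module _ (pp : Prime p) where

    private instance
      p≢0 : NonZero p
      p≢0 = prime⇒nonZero pp

    ∤⇒gcd≡1 : ∀ {u} → p ∤ u → gcd u p ≡ 1
    ∤⇒gcd≡1 {u} p∤u = coprime⇒gcd≡1 coprime
      where
      coprime : ∀ {d} → d ℕ∣.∣ u × d ℕ∣.∣ p → d ≡ 1
      coprime (d∣u , d∣p) with prime⇒irreducible pp d∣p
      ... | inj₁ d≡1  = d≡1
      ... | inj₂ refl = contradiction d∣u p∤u

    A⇒∤ : ∀ {u} → u ∈ A → p ∤ ∣ u ∣
    A⇒∤ (a , refl , _ , _ , gcd≡1) p∣a =
      ℕ.nonTrivial⇒≢1 {{prime⇒nonTrivial pp}} (gcd≡1⇒coprime gcd≡1 (p∣a , ℕ∣.∣-refl))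

    -- The weight is the residue of `z` modulo `p ^ (α ⊔ β)`, which also handles negative `z`. A
    -- nonzero `z` below `p` in absolute value is prime to `p`, and reduction preserves this because
    -- `1 ≤ α` makes `p` divide the modulus; in particular the residue is positive.
    small⇒unit : 1 ≤ α → ∀ z → z ≢ + 0 → ∣ z ∣ < p → ∃[ u ] (u ∈ A × u ≡ z [mod p ^ (α ⊔ β) ])
    small⇒unit 1≤α z z≢0 ∣z∣<p =
      + r , (r , refl , ℕ.n≢0⇒n>0 r≢0 , ℕ.<⇒≤ (n%ℕd<d z N) , ∤⇒gcd≡1 p∤r) , r≡z
      where
      N = p ^ (α ⊔ β)
      instance
        N≢0 : NonZero N
        N≢0 = ℕ.m^n≢0 p (α ⊔ β)

      r = z %ℕ N
      r≡z = %ℕ-≡mod z N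

      p∣N : + p ∣ + N
      p∣N = subst (λ k → + k ∣ + N) (ℕ.^-identityʳ p)
              (^-monoʳ-∣ p (ℕ.≤-trans 1≤α (ℕ.m≤m⊔n α β)))

      p∤z : p ∤ ∣ z ∣
      p∤z = ℕ∣.>⇒∤ {{ℕ.≢-nonZero (z≢0 ∘ ℤ.∣i∣≡0⇒i≡0)}} ∣z∣<p

      p∤r : p ∤ r
      p∤r p∣r = p∤z (∣⇒∣ᵤ (subst (+ p ∣_) (eq (+ r) z)
        (∣m∣n⇒∣m-n (∣ᵤ⇒∣ {+ p} {+ r} p∣r) (∣-trans p∣N r≡z))))
        where
        eq : ∀ r z → r ℤ.- (r ℤ.- z) ≡ z
        eq = solve-∀

      r≢0 : r ≢ 0
      r≢0 r≡0 = p∤r (subst (p ℕ∣.∣_) (sym r≡0) (p ℕ∣.∣0))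

    -- The outcome of deleting the terms with zero coefficient. Nonemptiness is conditional on a
    -- nonzero coefficient, so that the empty list has a thinning too and recursion on `xs` can
    -- start there.
    record Thinning (xs : List (ℤ × ℤ)) (c : Vector ℤ (length xs)) : Set where
      constructor thinning
      field
        {terms}  : List (ℤ × ℤ)
        terms⊆   : terms ⊆ xs
        nonempty : ∀ i → c i ≢ + 0 → 1 ≤ length terms
        weight   : Vector ℤ (length terms)
        weight∈A : ∀ i → weight i ∈ A
        sum≈     : sum (λ i → weight i · lookup terms i) G.≈ sum (λ i → c i · lookup xs i)

    skip : ∀ {x xs c} → c zero ≡ + 0 → Thinning xs (c ∘ suc) → Thinning (x ∷ xs) c
    skip {x} {xs} {c} c₀≡0 (thinning {ys} ys⊆xs nonempty u u∈A eq) = thinning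
      (x ∷ʳ ys⊆xs)
      (λ { zero c₀≢0 → contradiction c₀≡0 c₀≢0 ; (suc i) → nonempty i })
      u u∈A
      (subst (sum (λ i → u i · lookup ys i) G.≈_) (sym sum-skip) eq)
      where
      s = sum (λ i → c (suc i) · lookup xs i)
      sum-skip : c zero · x G.∙ s ≡ s
      sum-skip = trans (cong (λ z → z · x G.∙ s) c₀≡0)
                       (cong₂ _,_ (ℤ.+-identityˡ (proj₁ s)) (ℤ.+-identityˡ (proj₂ s)))

    keep : ∀ {x xs c} → ∃[ v ] (v ∈ A × v ≡ c zero [mod p ^ (α ⊔ β) ]) →
           Thinning xs (c ∘ suc) → Thinning (x ∷ xs) c
    keep {x} {xs} {c} (v , v∈A , v≡c₀) (thinning {ys} ys⊆xs _ u u∈A eq) = thinning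
      (refl ∷ ys⊆xs)
      (λ _ _ → s≤s z≤n)
      (λ { zero → v ; (suc i) → u i })
      (λ { zero → v∈A ; (suc i) → u∈A i })
      (G.∙-cong {v · x} {c zero · x}
                {sum (λ i → u i · lookup ys i)} {sum (λ i → c (suc i) · lookup xs i)}
                (·-congʳ-mod {v} {c zero} x v≡c₀) eq)

    drop-zeros : 1 ≤ α → ∀ xs c → (∀ i → ∣ c i ∣ < p) → Thinning xs c
    drop-zeros 1≤α []       c small = thinning [] (λ ()) (λ ()) (λ ()) (G.refl {G.ε})
    drop-zeros 1≤α (x ∷ xs) c small with c zero ℤ.≟ + 0
    ... | yes c₀≡0 = skip c₀≡0 (drop-zeros 1≤α xs (c ∘ suc) (small ∘ suc))
    ... | no  c₀≢0 = keep (small⇒unit 1≤α (c zero) c₀≢0 (small zero))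
                          (drop-zeros 1≤α xs (c ∘ suc) (small ∘ suc))

    shortZeroSum : 3 ≤ p → 1 ≤ α → ∀ xs → α + β + 1 ≤ length xs →
                   HasShortZeroSum G A (p ^ (α ⊔ β)) xs
    shortZeroSum 3≤p 1≤α xs k≤∣xs∣ =
      let c , small , (i , cᵢ≢0) , α∣ , β∣ =
            small-solution p (p ^ α) (p ^ β) {{ℕ.m^n≢0 p α}} {{ℕ.m^n≢0 p β}} room
              (proj₁ ∘ lookup zs) (proj₂ ∘ lookup zs)
          thinning {ys} ys⊆zs nonempty u u∈A eq = drop-zeros 1≤α zs c small
      in
        ys , ⊆-trans ys⊆zs (take-⊆ k xs)
      , ℕ.≤-trans (length-mono-≤ ys⊆zs) (subst (_≤ p ^ (α ⊔ β)) (sym ∣zs∣≡k) k≤exponent)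
      , nonempty i cᵢ≢0 , u , u∈A
      , G.trans {sum (λ i → u i · lookup ys i)} {sum (λ i → c i · lookup zs i)} {G.ε} eq
          (subst (G._≈ G.ε) (sym (sum-componentwise c (lookup zs))) (∣⇒≈ε α∣ β∣))
      where
      k = α + β + 1
      -- Truncating to exactly `k` terms bounds the length of the subsequence by `k`, hence by the
      -- exponent, however long `xs` is.
      zs = take k xs

      ∣zs∣≡k : length zs ≡ k
      ∣zs∣≡k = trans (length-take k xs) (ℕ.m≤n⇒m⊓n≡m k≤∣xs∣)

      -- There are `p ^ (α + β)` pairs of residues against `p ^ (α + β + 1)` coefficient vectors.
      room : p ^ α * p ^ β < p ^ length zs
      room = subst₂ _<_ (ℕ.^-distribˡ-+-* p α β) (cong (p ^_) (sym ∣zs∣≡k))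
        (ℕ.^-monoʳ-< p (ℕ.≤-trans (s≤s (s≤s z≤n)) 3≤p) (ℕ.m<m+n (α + β) (s≤s z≤n)))

      k≤exponent : k ≤ p ^ (α ⊔ β)
      k≤exponent = begin
        α + β + 1                    ≡⟨ ℕ.+-comm (α + β) 1 ⟩
        suc (α + β)                  ≤⟨ s≤s (ℕ.+-mono-≤ (ℕ.m≤m⊔n α β) (ℕ.m≤n⊔m α β)) ⟩
        suc ((α ⊔ β) + (α ⊔ β))      ≤⟨ 1+n+n≤p^n 3≤p (α ⊔ β) ⟩
        p ^ (α ⊔ β)                  ∎
        where open ℕ.≤-Reasoning

    -- Zero-sum free sequences and the lower bound.

    -- Modulo `p ^ suc i` only the head term `u zero * p ^ i` remains; if it vanished there,
    -- cancelling `p ^ i` would give `p` dividing `u zero`.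
    ∤-dot : ∀ {n e i} (u x : Vector ℤ (suc n)) → i < e → p ∤ ∣ u zero ∣ → x zero ≡ + (p ^ i) →
            (∀ j → + (p ^ suc i) ∣ x (suc j)) → ¬ + (p ^ e) ∣ dot u x
    ∤-dot {i = i} u x i<e p∤u₀ x₀≡pⁱ p^1+i∣x p^e∣dot =
      p∤u₀ (∣⇒∣ᵤ {+ p} {u zero} (*-cancelʳ-∣ (+ (p ^ i)) {{ℕ.m^n≢0 p i}} p^1+i∣u₀pⁱ))
      where
      p^1+i∣u₀pⁱ : + p ℤ.* + (p ^ i) ∣ u zero ℤ.* + (p ^ i)
      p^1+i∣u₀pⁱ = subst₂ _∣_ (ℤ.pos-* p (p ^ i)) (cong (u zero ℤ.*_) x₀≡pⁱ)
        (∣m+n∣n⇒∣m {m = u zero ℤ.* x zero} (∣-trans (^-monoʳ-∣ p i<e) p^e∣dot)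
                   (∣-dot (u ∘ suc) (x ∘ suc) p^1+i∣x))

    ZeroSumFree : List (ℤ × ℤ) → Set
    ZeroSumFree xs = ∀ {ys} → ys ⊆ xs → ¬ WeightedZeroSum G A ys

    -- Abstracts one coordinate, with projection `π`, embedding `ι` and modulus `p ^ e`, so that a
    -- single argument serves both coordinates.
    module Powers
      (π : ℤ × ℤ → ℤ) (ι : ℤ → ℤ × ℤ) (π-ι : ∀ z → π (ι z) ≡ z) (e : ℕ)
      (π-zero-sum : ∀ {n} (u : Vector ℤ n) (x : Vector (ℤ × ℤ) n) →
                    sum (λ i → u i · x i) G.≈ G.ε → + (p ^ e) ∣ dot u (π ∘ x))
      where

      -- A sublist without the new head is covered by `free`. In one that contains it, the head is
      -- the only term not divisible by `p ^ suc i` under `π`, so `∤-dot` applies.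
      ∷-zeroSumFree : ∀ {i xs} → i < e → All (λ x → + (p ^ suc i) ∣ π x) xs →
                      ZeroSumFree xs → ZeroSumFree (ι (+ (p ^ i)) ∷ xs)
      ∷-zeroSumFree i<e p∣xs free (_ ∷ʳ ys⊆xs) zeroSum = free ys⊆xs zeroSum
      ∷-zeroSumFree {i} i<e p∣xs free {y ∷ ys} (refl ∷ ys⊆xs) (_ , u , u∈A , eq) =
        ∤-dot u (π ∘ lookup (y ∷ ys)) i<e (A⇒∤ (u∈A zero)) (π-ι (+ (p ^ i)))
          (λ j → All.lookup (All-resp-⊆ ys⊆xs p∣xs) (∈-lookup j))
          (π-zero-sum u (lookup (y ∷ ys)) eq)

      powers : ℕ → ℕ → List (ℤ × ℤ) → List (ℤ × ℤ)
      powers i zero    xs = xs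
      powers i (suc k) xs = ι (+ (p ^ i)) ∷ powers (suc i) k xs

      length-powers : ∀ i k xs → length (powers i k xs) ≡ k + length xs
      length-powers i zero    xs = refl
      length-powers i (suc k) xs = cong suc (length-powers (suc i) k xs)

      All-powers : ∀ {P : ℤ × ℤ → Set} {i} k {xs} → (∀ {j} → i ≤ j → P (ι (+ (p ^ j)))) →
                   All P xs → All P (powers i k xs)
      All-powers zero    P-power Pxs = Pxs
      All-powers (suc k) P-power Pxs =
        P-power ℕ.≤-refl ∷ All-powers k (P-power ∘ ℕ.<⇒≤) Pxs

      -- Exponents increase along the list, so each head has the least power among the terms from it
      -- onwards, and `i + k ≤ e` keeps every exponent below `e`. The tail vanishes under `π`, which
      -- leaves room for the other coordinate's powers.
      powers-zeroSumFree : ∀ i k {xs} → i + k ≤ e → All (λ x → π x ≡ + 0) xs →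
                           ZeroSumFree xs → ZeroSumFree (powers i k xs)
      powers-zeroSumFree i zero    _     _    free = free
      powers-zeroSumFree i (suc k) i+k≤e π≡0 free =
        ∷-zeroSumFree (ℕ.≤-trans (s≤s (ℕ.m≤m+n i k)) 1+i+k≤e)
          (All-powers k (λ i<j → subst (_ ∣_) (sym (π-ι _)) (^-monoʳ-∣ p i<j))
            (All.map (λ eq → subst (_ ∣_) (sym eq) (divides (+ 0) refl)) π≡0))
          (powers-zeroSumFree (suc i) k 1+i+k≤e π≡0 free)
        where
        1+i+k≤e = subst (_≤ e) (ℕ.+-suc i k) i+k≤e

    module P₁ = Powers proj₁ (_, + 0) (λ _ → refl) α
      (λ u x → proj₁ ∘ sum≈ε⇒∣ u x)
    module P₂ = Powers proj₂ (+ 0 ,_) (λ _ → refl) β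
      (λ u x → proj₂ ∘ sum≈ε⇒∣ u x)

    extremal : List (ℤ × ℤ)
    extremal = P₁.powers 0 α (P₂.powers 0 β [])

    length-extremal : length extremal ≡ α + β
    length-extremal = trans (P₁.length-powers 0 α _)
      (cong (_+_ α) (trans (P₂.length-powers 0 β []) (ℕ.+-identityʳ β)))

    extremal-zeroSumFree : ZeroSumFree extremal
    extremal-zeroSumFree = P₁.powers-zeroSumFree 0 α ℕ.≤-refl (P₂.All-powers β (λ _ → refl) [])
      -- The empty list is zero-sum free because a weighted zero-sum has length at least 1.
      (P₂.powers-zeroSumFree 0 β ℕ.≤-refl [] λ { [] (() , _) })

-- Combining the two bounds.

3≤odd-prime : ∀ {p} → Prime p → 2 ∤ p → 3 ≤ p
3≤odd-prime pp 2∤p = ℕ.≤∧≢⇒< (ℕ.nonTrivial⇒n>1 _ {{prime⇒nonTrivial pp}})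
  λ { refl → 2∤p ℕ∣.∣-refl }

theorem6p1 : (p α β : ℕ) → Prime p → 2 ∤ p → 1 ≤ α → 1 ≤ β →
    IsEta (ℤ-mod (p ^ α) ⊕ ℤ-mod (p ^ β)) (UnitWeights p α β) (α + β + 1)
theorem6p1 p α β pp 2∤p 1≤α 1≤β =
    p ^ (α ⊔ β) , exponent p α β {{prime⇒nonZero pp}}
  , shortZeroSum p α β pp (3≤odd-prime pp 2∤p) 1≤α , least
  where
  G = ℤ-mod (p ^ α) ⊕ ℤ-mod (p ^ β)

  least : ∀ k → (∀ xs → k ≤ length xs → HasShortZeroSum G (UnitWeights p α β) (p ^ (α ⊔ β)) xs) →
          α + β + 1 ≤ k
  least k short with k ℕ.≤? α + β
  ... | no  k≰α+β = subst (_≤ k) (ℕ.+-comm 1 (α + β)) (ℕ.≰⇒> k≰α+β)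
  -- Such a `k` would force a zero-sum subsequence of `extremal`, whose length is `α + β`.
  ... | yes k≤α+β
    with ys , ys⊆ , _ , zeroSum ← short (extremal p α β pp)
           (subst (k ≤_) (sym (length-extremal p α β pp)) k≤α+β) =
    contradiction zeroSum (extremal-zeroSumFree p α β pp ys⊆)
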